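{- In the un-typed $\overline{\lambda}\mu\tilde{\mu}$-calculus, the $\mu\tilde{\mu}$-reduction is strongly normalizing: no ($c$-, $l$- or $r$-) term has an infinite sequence of $\mu\tilde{\mu}$-reduction steps.
   Context: Syntax of the un-typed $\overline{\lambda}\mu\tilde{\mu}$-calculus. There are $l$-variables $x,y,\dots$ and $r$-variables $\alpha,\beta,\dots$, and three kinds of terms: $c ::= \langle t_l,t_r\rangle$ ($c$-terms); $t_l ::= x \mid \lambda x\, t_l \mid \mu\alpha\, c \mid t_r.t_l$ ($l$-terms); $t_r ::= \alpha \mid \lambda\alpha\, t_r \mid \mu x\, c \mid t_l.t_r$ ($r$-terms). The constructors $\lambda x,\lambda\alpha,\mu x,\mu\alpha$ bind their variable; terms are considered up to renaming of bound variables and substitution is capture-avoiding. The $\mu\tilde\mu$-reduction is the closure under all term constructors of the two rules $\langle\mu\alpha\,c,\,t_r\rangle\triangleright_{\mu}c[\alpha:=t_r]$ and $\langle t_l,\,\mu x\,c\rangle\triangleright_{\tilde\mu}c[x:=t_l]$. -}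

module Defs where

open import Data.Fin.Base using (Fin; zero; suc)
open import Data.Nat.Base using (ℕ; suc)
open import Function.Base using (_∘_; id)

-- Terms up to renaming of bound variables are represented by well-scoped
-- de Bruijn terms.  The l-variables and the r-variables are two independent
-- namespaces: a term in  Term k m n  has its free l-variables among m given
-- ones and its free r-variables among n given ones.

data Kind : Set where
  c l r : Kind

variable
  k         : Kind
  m n m′ n′ : ℕ

infixr 6 _·ˡ_ _·ʳ_

data Term : Kind → ℕ → ℕ → Set where
  ⟨_∣_⟩ : Term l m n → Term r m n → Term c m n

  varˡ  : Fin m → Term l m n
  -- λx tₗ : binds an l-variable
  ƛˡ    : Term l (suc m) n → Term l m n
  -- μα c : an l-term binding an r-variable
  μˡ    : Term c m (suc n) → Term l m n
  -- tᵣ.tₗ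
  _·ˡ_  : Term r m n → Term l m n → Term l m n

  varʳ  : Fin n → Term r m n
  -- λα tᵣ : binds an r-variable
  ƛʳ    : Term r m (suc n) → Term r m n
  -- μx c : an r-term binding an l-variable
  μʳ    : Term c (suc m) n → Term r m n
  -- tₗ.tᵣ
  _·ʳ_  : Term l m n → Term r m n → Term r m n

Ren : ℕ → ℕ → Set
Ren m m′ = Fin m → Fin m′

extᴿ : Ren m m′ → Ren (suc m) (suc m′)
extᴿ ρ zero    = zero
extᴿ ρ (suc i) = suc (ρ i)

rename : Ren m m′ → Ren n n′ → Term k m n → Term k m′ n′
rename ρ θ ⟨ t ∣ u ⟩ = ⟨ rename ρ θ t ∣ rename ρ θ u ⟩
rename ρ θ (varˡ x)  = varˡ (ρ x)
rename ρ θ (ƛˡ t)    = ƛˡ (rename (extᴿ ρ) θ t)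
rename ρ θ (μˡ d)    = μˡ (rename ρ (extᴿ θ) d)
rename ρ θ (u ·ˡ t)  = rename ρ θ u ·ˡ rename ρ θ t
rename ρ θ (varʳ α)  = varʳ (θ α)
rename ρ θ (ƛʳ u)    = ƛʳ (rename ρ (extᴿ θ) u)
rename ρ θ (μʳ d)    = μʳ (rename (extᴿ ρ) θ d)
rename ρ θ (t ·ʳ u)  = rename ρ θ t ·ʳ rename ρ θ u

wkˡ : Term k m n → Term k (suc m) n
wkˡ = rename suc id

wkʳ : Term k m n → Term k m (suc n)
wkʳ = rename id suc

-- A simultaneous substitution is a pair of a Subˡ (for the l-variables)
-- and a Subʳ (for the r-variables) into the same scope.

Subˡ : ℕ → ℕ → ℕ → Set
Subˡ m m′ n′ = Fin m → Term l m′ n′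

Subʳ : ℕ → ℕ → ℕ → Set
Subʳ n m′ n′ = Fin n → Term r m′ n′

extˡ : Subˡ m m′ n′ → Subˡ (suc m) (suc m′) n′
extˡ σ zero    = varˡ zero
extˡ σ (suc x) = wkˡ (σ x)

extʳ : Subʳ n m′ n′ → Subʳ (suc n) m′ (suc n′)
extʳ τ zero    = varʳ zero
extʳ τ (suc α) = wkʳ (τ α)

subst : Subˡ m m′ n′ → Subʳ n m′ n′ → Term k m n → Term k m′ n′
subst σ τ ⟨ t ∣ u ⟩ = ⟨ subst σ τ t ∣ subst σ τ u ⟩
subst σ τ (varˡ x)  = σ x
subst σ τ (ƛˡ t)    = ƛˡ (subst (extˡ σ) (wkˡ ∘ τ) t)
subst σ τ (μˡ d)    = μˡ (subst (wkʳ ∘ σ) (extʳ τ) d)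
subst σ τ (u ·ˡ t)  = subst σ τ u ·ˡ subst σ τ t
subst σ τ (varʳ α)  = τ α
subst σ τ (ƛʳ u)    = ƛʳ (subst (wkʳ ∘ σ) (extʳ τ) u)
subst σ τ (μʳ d)    = μʳ (subst (extˡ σ) (wkˡ ∘ τ) d)
subst σ τ (t ·ʳ u)  = subst σ τ t ·ʳ subst σ τ u

singleˡ : Term l m n → Subˡ (suc m) m n
singleˡ t zero    = t
singleˡ t (suc x) = varˡ x

singleʳ : Term r m n → Subʳ (suc n) m n
singleʳ u zero    = u
singleʳ u (suc α) = varʳ α

-- d [ t ]ˡ  is  d[x := t]  and  d [ u ]ʳ  is  d[α := u],  where x (resp. α)
-- is the most recently bound l-variable (resp. r-variable).

infix 8 _[_]ˡ _[_]ʳ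

_[_]ˡ : Term k (suc m) n → Term l m n → Term k m n
d [ t ]ˡ = subst (singleˡ t) varʳ d

_[_]ʳ : Term k m (suc n) → Term r m n → Term k m n
d [ u ]ʳ = subst varˡ (singleʳ u) d

infix 4 _⟶_ _⟵_

data _⟶_ : Term k m n → Term k m n → Set where
  μ-red : (d : Term c m (suc n)) (u : Term r m n) → ⟨ μˡ d ∣ u ⟩ ⟶ d [ u ]ʳ
  μ̃-red : (t : Term l m n) (d : Term c (suc m) n) → ⟨ t ∣ μʳ d ⟩ ⟶ d [ t ]ˡ

  cut₁ : {t t′ : Term l m n} {u : Term r m n} → t ⟶ t′ → ⟨ t ∣ u ⟩ ⟶ ⟨ t′ ∣ u ⟩
  cut₂ : {t : Term l m n} {u u′ : Term r m n} → u ⟶ u′ → ⟨ t ∣ u ⟩ ⟶ ⟨ t ∣ u′ ⟩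

  ƛˡ-cong : {t t′ : Term l (suc m) n} → t ⟶ t′ → ƛˡ t ⟶ ƛˡ t′
  μˡ-cong : {d d′ : Term c m (suc n)} → d ⟶ d′ → μˡ d ⟶ μˡ d′
  ·ˡ₁     : {u u′ : Term r m n} {t : Term l m n} → u ⟶ u′ → u ·ˡ t ⟶ u′ ·ˡ t
  ·ˡ₂     : {u : Term r m n} {t t′ : Term l m n} → t ⟶ t′ → u ·ˡ t ⟶ u ·ˡ t′

  ƛʳ-cong : {u u′ : Term r m (suc n)} → u ⟶ u′ → ƛʳ u ⟶ ƛʳ u′
  μʳ-cong : {d d′ : Term c (suc m) n} → d ⟶ d′ → μʳ d ⟶ μʳ d′
  ·ʳ₁     : {t t′ : Term l m n} {u : Term r m n} → t ⟶ t′ → t ·ʳ u ⟶ t′ ·ʳ u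
  ·ʳ₂     : {t : Term l m n} {u u′ : Term r m n} → u ⟶ u′ → t ·ʳ u ⟶ t ·ʳ u′

-- A reduct counts as smaller, so that an infinite ⟵-descending sequence is
-- an infinite reduction sequence.
_⟵_ : Term k m n → Term k m n → Set
t′ ⟵ t = t ⟶ t′

{-# OPTIONS --safe #-}

-- Write SN for strong normalisation.  Call an l-term T good if it is SN and,
-- when T = μα c, c[α:=Q] is SN for every SN r-term Q.
-- (1) Substituting good l-terms for the l-variables of an SN term gives an SN
--     term.  (2) Substituting SN r-terms for the r-variables of an SN l-term
--     gives a good l-term.
-- Both are proved by induction along "is a reduct or a proper subterm of".  The
-- critical cuts are ⟨x|q⟩ for (1), settled by goodness of the term substituted
-- for x, and ⟨p|α⟩ for (2), where p becomes a good term by induction, so that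
-- (1) applies to the body of an r-term μx d substituted for α.
-- By (2) every SN l-term is good, and by (1) a cut of SN terms is SN.
module Submission where

open import Defs
open import Data.Fin.Base using (zero; suc)
open import Data.Nat.Base using (ℕ; suc)
open import Data.Product.Base using (∃-syntax; _,_)
open import Function.Base using (_∘_; id)
open import Induction.InfiniteDescent
  using (InfiniteDescendingSequence; InfiniteDescendingSequenceFrom)
open import Induction.WellFounded using (Acc; acc; acc-inverse)
open import Relation.Binary.Construct.Closure.ReflexiveTransitive
  using (Star; ε; _◅_; _◅◅_; gmap)
open import Relation.Binary.PropositionalEquality
  using (_≡_; refl; sym; trans; cong; cong₂)
  renaming (subst to transport)
open import Relation.Nullary.Negation.Core using (¬_)

private variable
  k₁ : Kind
  m₁ m₂ n₁ n₂ : ℕ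

-- Renaming and substitution

-- The fusion laws take the composite as an argument together with a pointwise
-- equation, since function extensionality is not available.

extᴿ-∘ : {ρ : Ren m m₁} {ρ₁ : Ren m₁ m₂} {ρ₂ : Ren m m₂} →
  (∀ x → ρ₁ (ρ x) ≡ ρ₂ x) → ∀ x → extᴿ ρ₁ (extᴿ ρ x) ≡ extᴿ ρ₂ x
extᴿ-∘ e zero    = refl
extᴿ-∘ e (suc x) = cong suc (e x)

rename-rename : {ρ : Ren m m₁} {θ : Ren n n₁} {ρ₁ : Ren m₁ m₂} {θ₁ : Ren n₁ n₂}
  {ρ₂ : Ren m m₂} {θ₂ : Ren n n₂} →
  (∀ x → ρ₁ (ρ x) ≡ ρ₂ x) → (∀ α → θ₁ (θ α) ≡ θ₂ α) → (t : Term k m n) →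
  rename ρ₁ θ₁ (rename ρ θ t) ≡ rename ρ₂ θ₂ t
rename-rename e h ⟨ t ∣ u ⟩ = cong₂ ⟨_∣_⟩ (rename-rename e h t) (rename-rename e h u)
rename-rename e h (varˡ x) = cong varˡ (e x)
rename-rename e h (ƛˡ t) = cong ƛˡ (rename-rename (extᴿ-∘ e) h t)
rename-rename e h (μˡ d) = cong μˡ (rename-rename e (extᴿ-∘ h) d)
rename-rename e h (u ·ˡ t) = cong₂ _·ˡ_ (rename-rename e h u) (rename-rename e h t)
rename-rename e h (varʳ α) = cong varʳ (h α)
rename-rename e h (ƛʳ u) = cong ƛʳ (rename-rename e (extᴿ-∘ h) u)
rename-rename e h (μʳ d) = cong μʳ (rename-rename (extᴿ-∘ e) h d)
rename-rename e h (t ·ʳ u) = cong₂ _·ʳ_ (rename-rename e h t) (rename-rename e h u)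

extˡ-extᴿ : {ρ : Ren m m₁} {σ : Subˡ m₁ m₂ n} {σ₁ : Subˡ m m₂ n} →
  (∀ x → σ (ρ x) ≡ σ₁ x) → ∀ x → extˡ σ (extᴿ ρ x) ≡ extˡ σ₁ x
extˡ-extᴿ e zero    = refl
extˡ-extᴿ e (suc x) = cong wkˡ (e x)

extʳ-extᴿ : {θ : Ren n n₁} {τ : Subʳ n₁ m n₂} {τ₁ : Subʳ n m n₂} →
  (∀ α → τ (θ α) ≡ τ₁ α) → ∀ α → extʳ τ (extᴿ θ α) ≡ extʳ τ₁ α
extʳ-extᴿ h zero    = refl
extʳ-extᴿ h (suc α) = cong wkʳ (h α)

subst-rename : {ρ : Ren m m₁} {θ : Ren n n₁} {σ : Subˡ m₁ m₂ n₂} {τ : Subʳ n₁ m₂ n₂}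
  {σ₁ : Subˡ m m₂ n₂} {τ₁ : Subʳ n m₂ n₂} →
  (∀ x → σ (ρ x) ≡ σ₁ x) → (∀ α → τ (θ α) ≡ τ₁ α) → (t : Term k m n) →
  subst σ τ (rename ρ θ t) ≡ subst σ₁ τ₁ t
subst-rename e h ⟨ t ∣ u ⟩ = cong₂ ⟨_∣_⟩ (subst-rename e h t) (subst-rename e h u)
subst-rename e h (varˡ x) = e x
subst-rename e h (ƛˡ t) = cong ƛˡ (subst-rename (extˡ-extᴿ e) (cong wkˡ ∘ h) t)
subst-rename e h (μˡ d) = cong μˡ (subst-rename (cong wkʳ ∘ e) (extʳ-extᴿ h) d)
subst-rename e h (u ·ˡ t) = cong₂ _·ˡ_ (subst-rename e h u) (subst-rename e h t)
subst-rename e h (varʳ α) = h α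
subst-rename e h (ƛʳ u) = cong ƛʳ (subst-rename (cong wkʳ ∘ e) (extʳ-extᴿ h) u)
subst-rename e h (μʳ d) = cong μʳ (subst-rename (extˡ-extᴿ e) (cong wkˡ ∘ h) d)
subst-rename e h (t ·ʳ u) = cong₂ _·ʳ_ (subst-rename e h t) (subst-rename e h u)

rename-wkˡ : {ρ : Ren m m₁} {θ : Ren n n₁} (t : Term k m n) →
  rename (extᴿ ρ) θ (wkˡ t) ≡ wkˡ (rename ρ θ t)
rename-wkˡ t = trans (rename-rename (λ _ → refl) (λ _ → refl) t)
  (sym (rename-rename (λ _ → refl) (λ _ → refl) t))

rename-wkʳ : {ρ : Ren m m₁} {θ : Ren n n₁} (t : Term k m n) →
  rename ρ (extᴿ θ) (wkʳ t) ≡ wkʳ (rename ρ θ t)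
rename-wkʳ t = trans (rename-rename (λ _ → refl) (λ _ → refl) t)
  (sym (rename-rename (λ _ → refl) (λ _ → refl) t))

rename-extˡ : {ρ : Ren m₁ m₂} {θ : Ren n₁ n₂} {σ : Subˡ m m₁ n₁} {σ₁ : Subˡ m m₂ n₂} →
  (∀ x → rename ρ θ (σ x) ≡ σ₁ x) → ∀ x → rename (extᴿ ρ) θ (extˡ σ x) ≡ extˡ σ₁ x
rename-extˡ e zero = refl
rename-extˡ {σ = σ} e (suc x) = trans (rename-wkˡ (σ x)) (cong wkˡ (e x))

rename-extʳ : {ρ : Ren m₁ m₂} {θ : Ren n₁ n₂} {τ : Subʳ n m₁ n₁} {τ₁ : Subʳ n m₂ n₂} →
  (∀ α → rename ρ θ (τ α) ≡ τ₁ α) → ∀ α → rename ρ (extᴿ θ) (extʳ τ α) ≡ extʳ τ₁ α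
rename-extʳ h zero = refl
rename-extʳ {τ = τ} h (suc α) = trans (rename-wkʳ (τ α)) (cong wkʳ (h α))

rename-subst : {σ : Subˡ m m₁ n₁} {τ : Subʳ n m₁ n₁} {ρ : Ren m₁ m₂} {θ : Ren n₁ n₂}
  {σ₁ : Subˡ m m₂ n₂} {τ₁ : Subʳ n m₂ n₂} →
  (∀ x → rename ρ θ (σ x) ≡ σ₁ x) → (∀ α → rename ρ θ (τ α) ≡ τ₁ α) → (t : Term k m n) →
  rename ρ θ (subst σ τ t) ≡ subst σ₁ τ₁ t
rename-subst e h ⟨ t ∣ u ⟩ = cong₂ ⟨_∣_⟩ (rename-subst e h t) (rename-subst e h u)
rename-subst e h (varˡ x) = e x
rename-subst e h (ƛˡ t) =
  cong ƛˡ (rename-subst (rename-extˡ e) (λ α → trans (rename-wkˡ _) (cong wkˡ (h α))) t)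
rename-subst e h (μˡ d) =
  cong μˡ (rename-subst (λ x → trans (rename-wkʳ _) (cong wkʳ (e x))) (rename-extʳ h) d)
rename-subst e h (u ·ˡ t) = cong₂ _·ˡ_ (rename-subst e h u) (rename-subst e h t)
rename-subst e h (varʳ α) = h α
rename-subst e h (ƛʳ u) =
  cong ƛʳ (rename-subst (λ x → trans (rename-wkʳ _) (cong wkʳ (e x))) (rename-extʳ h) u)
rename-subst e h (μʳ d) =
  cong μʳ (rename-subst (rename-extˡ e) (λ α → trans (rename-wkˡ _) (cong wkˡ (h α))) d)
rename-subst e h (t ·ʳ u) = cong₂ _·ʳ_ (rename-subst e h t) (rename-subst e h u)

subst-wkˡ : {σ : Subˡ m m₁ n₁} {τ : Subʳ n m₁ n₁} (t : Term k m n) →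
  subst (extˡ σ) (wkˡ ∘ τ) (wkˡ t) ≡ wkˡ (subst σ τ t)
subst-wkˡ t = trans (subst-rename (λ _ → refl) (λ _ → refl) t)
  (sym (rename-subst (λ _ → refl) (λ _ → refl) t))

subst-wkʳ : {σ : Subˡ m m₁ n₁} {τ : Subʳ n m₁ n₁} (t : Term k m n) →
  subst (wkʳ ∘ σ) (extʳ τ) (wkʳ t) ≡ wkʳ (subst σ τ t)
subst-wkʳ t = trans (subst-rename (λ _ → refl) (λ _ → refl) t)
  (sym (rename-subst (λ _ → refl) (λ _ → refl) t))

subst-extˡ : {σ : Subˡ m m₁ n₁} {σ₁ : Subˡ m₁ m₂ n₂} {τ₁ : Subʳ n₁ m₂ n₂} {σ₂ : Subˡ m m₂ n₂} →
  (∀ x → subst σ₁ τ₁ (σ x) ≡ σ₂ x) →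
  ∀ x → subst (extˡ σ₁) (wkˡ ∘ τ₁) (extˡ σ x) ≡ extˡ σ₂ x
subst-extˡ e zero = refl
subst-extˡ {σ = σ} e (suc x) = trans (subst-wkˡ (σ x)) (cong wkˡ (e x))

subst-extʳ : {τ : Subʳ n m₁ n₁} {σ₁ : Subˡ m₁ m₂ n₂} {τ₁ : Subʳ n₁ m₂ n₂} {τ₂ : Subʳ n m₂ n₂} →
  (∀ α → subst σ₁ τ₁ (τ α) ≡ τ₂ α) →
  ∀ α → subst (wkʳ ∘ σ₁) (extʳ τ₁) (extʳ τ α) ≡ extʳ τ₂ α
subst-extʳ h zero = refl
subst-extʳ {τ = τ} h (suc α) = trans (subst-wkʳ (τ α)) (cong wkʳ (h α))

subst-subst : {σ : Subˡ m m₁ n₁} {τ : Subʳ n m₁ n₁} {σ₁ : Subˡ m₁ m₂ n₂} {τ₁ : Subʳ n₁ m₂ n₂}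
  {σ₂ : Subˡ m m₂ n₂} {τ₂ : Subʳ n m₂ n₂} →
  (∀ x → subst σ₁ τ₁ (σ x) ≡ σ₂ x) → (∀ α → subst σ₁ τ₁ (τ α) ≡ τ₂ α) → (t : Term k m n) →
  subst σ₁ τ₁ (subst σ τ t) ≡ subst σ₂ τ₂ t
subst-subst e h ⟨ t ∣ u ⟩ = cong₂ ⟨_∣_⟩ (subst-subst e h t) (subst-subst e h u)
subst-subst e h (varˡ x) = e x
subst-subst {τ = τ} e h (ƛˡ t) =
  cong ƛˡ (subst-subst (subst-extˡ e) (λ α → trans (subst-wkˡ (τ α)) (cong wkˡ (h α))) t)
subst-subst {σ = σ} e h (μˡ d) =
  cong μˡ (subst-subst (λ x → trans (subst-wkʳ (σ x)) (cong wkʳ (e x))) (subst-extʳ h) d)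
subst-subst e h (u ·ˡ t) = cong₂ _·ˡ_ (subst-subst e h u) (subst-subst e h t)
subst-subst e h (varʳ α) = h α
subst-subst {σ = σ} e h (ƛʳ u) =
  cong ƛʳ (subst-subst (λ x → trans (subst-wkʳ (σ x)) (cong wkʳ (e x))) (subst-extʳ h) u)
subst-subst {τ = τ} e h (μʳ d) =
  cong μʳ (subst-subst (subst-extˡ e) (λ α → trans (subst-wkˡ (τ α)) (cong wkˡ (h α))) d)
subst-subst e h (t ·ʳ u) = cong₂ _·ʳ_ (subst-subst e h t) (subst-subst e h u)

extˡ-var : {σ : Subˡ m m n} → (∀ x → σ x ≡ varˡ x) → ∀ x → extˡ σ x ≡ varˡ x
extˡ-var e zero    = refl
extˡ-var e (suc x) = cong wkˡ (e x)

extʳ-var : {τ : Subʳ n m n} → (∀ α → τ α ≡ varʳ α) → ∀ α → extʳ τ α ≡ varʳ α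
extʳ-var h zero    = refl
extʳ-var h (suc α) = cong wkʳ (h α)

subst-var : {σ : Subˡ m m n} {τ : Subʳ n m n} →
  (∀ x → σ x ≡ varˡ x) → (∀ α → τ α ≡ varʳ α) → (t : Term k m n) → subst σ τ t ≡ t
subst-var e h ⟨ t ∣ u ⟩ = cong₂ ⟨_∣_⟩ (subst-var e h t) (subst-var e h u)
subst-var e h (varˡ x) = e x
subst-var e h (ƛˡ t) = cong ƛˡ (subst-var (extˡ-var e) (cong wkˡ ∘ h) t)
subst-var e h (μˡ d) = cong μˡ (subst-var (cong wkʳ ∘ e) (extʳ-var h) d)
subst-var e h (u ·ˡ t) = cong₂ _·ˡ_ (subst-var e h u) (subst-var e h t)
subst-var e h (varʳ α) = h α
subst-var e h (ƛʳ u) = cong ƛʳ (subst-var (cong wkʳ ∘ e) (extʳ-var h) u)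
subst-var e h (μʳ d) = cong μʳ (subst-var (extˡ-var e) (cong wkˡ ∘ h) d)
subst-var e h (t ·ʳ u) = cong₂ _·ʳ_ (subst-var e h t) (subst-var e h u)

-- Transfers facts about substitution to renaming, as in `rename-id` and `rename-⟶`.
rename-as-subst : (ρ : Ren m m₁) (θ : Ren n n₁) (t : Term k m n) →
  rename ρ θ t ≡ subst (varˡ ∘ ρ) (varʳ ∘ θ) t
rename-as-subst ρ θ t =
  trans (cong (rename ρ θ) (sym (subst-var (λ _ → refl) (λ _ → refl) t)))
    (rename-subst (λ _ → refl) (λ _ → refl) t)

rename-id : (t : Term k m n) → rename id id t ≡ t
rename-id t = trans (rename-as-subst id id t) (subst-var (λ _ → refl) (λ _ → refl) t)

-- Instantiating the most recently bound variable

infixl 5 _▹ˡ_ _▹ʳ_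

_▹ˡ_ : Subˡ m m₁ n₁ → Term l m₁ n₁ → Subˡ (suc m) m₁ n₁
(σ ▹ˡ t) zero    = t
(σ ▹ˡ t) (suc x) = σ x

_▹ʳ_ : Subʳ n m₁ n₁ → Term r m₁ n₁ → Subʳ (suc n) m₁ n₁
(τ ▹ʳ u) zero    = u
(τ ▹ʳ u) (suc α) = τ α

wkˡ-[]ˡ : (s : Term k m n) (t : Term l m n) → wkˡ s [ t ]ˡ ≡ s
wkˡ-[]ˡ s t = trans (subst-rename (λ _ → refl) (λ _ → refl) s)
  (subst-var (λ _ → refl) (λ _ → refl) s)

wkʳ-[]ʳ : (s : Term k m n) (u : Term r m n) → wkʳ s [ u ]ʳ ≡ s
wkʳ-[]ʳ s u = trans (subst-rename (λ _ → refl) (λ _ → refl) s)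
  (subst-var (λ _ → refl) (λ _ → refl) s)

subst-ext-[]ˡ : (σ : Subˡ m m₁ n₁) (τ : Subʳ n m₁ n₁) (d : Term k (suc m) n) (t : Term l m₁ n₁) →
  subst (extˡ σ) (wkˡ ∘ τ) d [ t ]ˡ ≡ subst (σ ▹ˡ t) τ d
subst-ext-[]ˡ σ τ d t =
  subst-subst (λ { zero → refl ; (suc x) → wkˡ-[]ˡ (σ x) t }) (λ α → wkˡ-[]ˡ (τ α) t) d

-- Entering a binder and then instantiating it fuses into one substitution. In `root` this turns a
-- contraction into a substitution into the body `d`, a proper subterm.
subst-ext-[]ʳ : (σ : Subˡ m m₁ n₁) (τ : Subʳ n m₁ n₁) (d : Term k m (suc n)) (u : Term r m₁ n₁) →
  subst (wkʳ ∘ σ) (extʳ τ) d [ u ]ʳ ≡ subst σ (τ ▹ʳ u) d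
subst-ext-[]ʳ σ τ d u =
  subst-subst (λ x → wkʳ-[]ʳ (σ x) u) (λ { zero → refl ; (suc α) → wkʳ-[]ʳ (τ α) u }) d

-- Both sides fuse to the result of applying `σ ▹ˡ subst σ τ t` and `τ` to `d`. This is what makes
-- root contractions stable under substitution.
subst-[]ˡ : (σ : Subˡ m m₁ n₁) (τ : Subʳ n m₁ n₁) (d : Term k (suc m) n) (t : Term l m n) →
  subst σ τ (d [ t ]ˡ) ≡ subst (extˡ σ) (wkˡ ∘ τ) d [ subst σ τ t ]ˡ
subst-[]ˡ σ τ d t = trans
  (subst-subst (λ { zero → refl ; (suc x) → refl }) (λ _ → refl) d)
  (sym (subst-ext-[]ˡ σ τ d (subst σ τ t)))

subst-[]ʳ : (σ : Subˡ m m₁ n₁) (τ : Subʳ n m₁ n₁) (d : Term k m (suc n)) (u : Term r m n) →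
  subst σ τ (d [ u ]ʳ) ≡ subst (wkʳ ∘ σ) (extʳ τ) d [ subst σ τ u ]ʳ
subst-[]ʳ σ τ d u = trans
  (subst-subst (λ _ → refl) (λ { zero → refl ; (suc α) → refl }) d)
  (sym (subst-ext-[]ʳ σ τ d (subst σ τ u)))

-- Reduction and substitution

infix 4 _⟶*_

_⟶*_ : Term k m n → Term k m n → Set
_⟶*_ = Star _⟶_

subst-⟶ : (σ : Subˡ m m₁ n₁) (τ : Subʳ n m₁ n₁) {t t′ : Term k m n} →
  t ⟶ t′ → subst σ τ t ⟶ subst σ τ t′
subst-⟶ σ τ (μ-red d u)  =
  transport (subst σ τ ⟨ μˡ d ∣ u ⟩ ⟶_) (sym (subst-[]ʳ σ τ d u)) (μ-red _ _)
subst-⟶ σ τ (μ̃-red t d)  =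
  transport (subst σ τ ⟨ t ∣ μʳ d ⟩ ⟶_) (sym (subst-[]ˡ σ τ d t)) (μ̃-red _ _)
subst-⟶ σ τ (cut₁ p)     = cut₁ (subst-⟶ σ τ p)
subst-⟶ σ τ (cut₂ p)     = cut₂ (subst-⟶ σ τ p)
subst-⟶ σ τ (ƛˡ-cong p)  = ƛˡ-cong (subst-⟶ _ _ p)
subst-⟶ σ τ (μˡ-cong p)  = μˡ-cong (subst-⟶ _ _ p)
subst-⟶ σ τ (·ˡ₁ p)      = ·ˡ₁ (subst-⟶ σ τ p)
subst-⟶ σ τ (·ˡ₂ p)      = ·ˡ₂ (subst-⟶ σ τ p)
subst-⟶ σ τ (ƛʳ-cong p)  = ƛʳ-cong (subst-⟶ _ _ p)
subst-⟶ σ τ (μʳ-cong p)  = μʳ-cong (subst-⟶ _ _ p)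
subst-⟶ σ τ (·ʳ₁ p)      = ·ʳ₁ (subst-⟶ σ τ p)
subst-⟶ σ τ (·ʳ₂ p)      = ·ʳ₂ (subst-⟶ σ τ p)

rename-⟶ : (ρ : Ren m m₁) (θ : Ren n n₁) {t t′ : Term k m n} →
  t ⟶ t′ → rename ρ θ t ⟶ rename ρ θ t′
rename-⟶ ρ θ {t} {t′} p
  rewrite rename-as-subst ρ θ t | rename-as-subst ρ θ t′ = subst-⟶ _ _ p

wkˡ-⟶* : {t t′ : Term k m n} → t ⟶* t′ → wkˡ t ⟶* wkˡ t′
wkˡ-⟶* = gmap wkˡ (rename-⟶ suc id)

wkʳ-⟶* : {t t′ : Term k m n} → t ⟶* t′ → wkʳ t ⟶* wkʳ t′
wkʳ-⟶* = gmap wkʳ (rename-⟶ id suc)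

extˡ-⟶* : {σ σ₁ : Subˡ m m₁ n₁} → (∀ x → σ x ⟶* σ₁ x) → ∀ x → extˡ σ x ⟶* extˡ σ₁ x
extˡ-⟶* e zero    = ε
extˡ-⟶* e (suc x) = wkˡ-⟶* (e x)

extʳ-⟶* : {τ τ₁ : Subʳ n m₁ n₁} → (∀ α → τ α ⟶* τ₁ α) → ∀ α → extʳ τ α ⟶* extʳ τ₁ α
extʳ-⟶* h zero    = ε
extʳ-⟶* h (suc α) = wkʳ-⟶* (h α)

-- A variable may occur any number of times, so a step in a substituted term is copied or erased;
-- hence many steps on the right.
subst-⟶* : {σ σ₁ : Subˡ m m₁ n₁} {τ τ₁ : Subʳ n m₁ n₁} →
  (∀ x → σ x ⟶* σ₁ x) → (∀ α → τ α ⟶* τ₁ α) → (t : Term k m n) →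
  subst σ τ t ⟶* subst σ₁ τ₁ t
subst-⟶* e h ⟨ t ∣ u ⟩ =
  gmap (⟨_∣ _ ⟩) cut₁ (subst-⟶* e h t) ◅◅ gmap (⟨ _ ∣_⟩) cut₂ (subst-⟶* e h u)
subst-⟶* e h (varˡ x) = e x
subst-⟶* e h (ƛˡ t)   = gmap ƛˡ ƛˡ-cong (subst-⟶* (extˡ-⟶* e) (wkˡ-⟶* ∘ h) t)
subst-⟶* e h (μˡ d)   = gmap μˡ μˡ-cong (subst-⟶* (wkʳ-⟶* ∘ e) (extʳ-⟶* h) d)
subst-⟶* e h (u ·ˡ t) =
  gmap (_·ˡ _) ·ˡ₁ (subst-⟶* e h u) ◅◅ gmap (_ ·ˡ_) ·ˡ₂ (subst-⟶* e h t)
subst-⟶* e h (varʳ α) = h α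
subst-⟶* e h (ƛʳ u)   = gmap ƛʳ ƛʳ-cong (subst-⟶* (wkʳ-⟶* ∘ e) (extʳ-⟶* h) u)
subst-⟶* e h (μʳ d)   = gmap μʳ μʳ-cong (subst-⟶* (extˡ-⟶* e) (wkˡ-⟶* ∘ h) d)
subst-⟶* e h (t ·ʳ u) =
  gmap (_·ʳ _) ·ʳ₁ (subst-⟶* e h t) ◅◅ gmap (_ ·ʳ_) ·ʳ₂ (subst-⟶* e h u)

[]ˡ-⟶* : (d : Term k (suc m) n) {t t′ : Term l m n} → t ⟶ t′ → d [ t ]ˡ ⟶* d [ t′ ]ˡ
[]ˡ-⟶* d p = subst-⟶* (λ { zero → p ◅ ε ; (suc x) → ε }) (λ _ → ε) d

[]ʳ-⟶* : (d : Term k m (suc n)) {u u′ : Term r m n} → u ⟶ u′ → d [ u ]ʳ ⟶* d [ u′ ]ʳ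
[]ʳ-⟶* d p = subst-⟶* (λ _ → ε) (λ { zero → p ◅ ε ; (suc α) → ε }) d

-- Strong normalisation

SN : Term k m n → Set
SN = Acc _⟵_

SN-⟶* : {t t′ : Term k m n} → SN t → t ⟶* t′ → SN t′
SN-⟶* a ε        = a
SN-⟶* a (p ◅ ps) = SN-⟶* (acc-inverse a p) ps

SN-varˡ : ∀ {x} → SN (varˡ {m} {n} x)
SN-varˡ = acc λ ()

SN-varʳ : ∀ {α} → SN (varʳ {n} {m} α)
SN-varʳ = acc λ ()

SN-ƛˡ : {t : Term l (suc m) n} → SN t → SN (ƛˡ t)
SN-ƛˡ (acc a) = acc λ { (ƛˡ-cong p) → SN-ƛˡ (a p) }

SN-μˡ : {d : Term c m (suc n)} → SN d → SN (μˡ d)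
SN-μˡ (acc a) = acc λ { (μˡ-cong p) → SN-μˡ (a p) }

SN-·ˡ : {u : Term r m n} {t : Term l m n} → SN u → SN t → SN (u ·ˡ t)
SN-·ˡ a@(acc a′) b@(acc b′) = acc λ { (·ˡ₁ p) → SN-·ˡ (a′ p) b ; (·ˡ₂ p) → SN-·ˡ a (b′ p) }

SN-ƛʳ : {u : Term r m (suc n)} → SN u → SN (ƛʳ u)
SN-ƛʳ (acc a) = acc λ { (ƛʳ-cong p) → SN-ƛʳ (a p) }

SN-μʳ : {d : Term c (suc m) n} → SN d → SN (μʳ d)
SN-μʳ (acc a) = acc λ { (μʳ-cong p) → SN-μʳ (a p) }

SN-·ʳ : {t : Term l m n} {u : Term r m n} → SN t → SN u → SN (t ·ʳ u)
SN-·ʳ a@(acc a′) b@(acc b′) = acc λ { (·ʳ₁ p) → SN-·ʳ (a′ p) b ; (·ʳ₂ p) → SN-·ʳ a (b′ p) }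

-- An l- or r-term never changes its head constructor under reduction, so only
-- the two root contractions of the given cut have to be examined.
SN-cut : {t : Term l m n} {u : Term r m n} → SN t → SN u →
  (∀ {d} → t ≡ μˡ d → SN (d [ u ]ʳ)) → (∀ {d} → u ≡ μʳ d → SN (d [ t ]ˡ)) → SN ⟨ t ∣ u ⟩
SN-cut {t = t} {u} a@(acc a′) b@(acc b′) f g = acc λ
  { (μ-red d u) → f refl
  ; (μ̃-red t d) → g refl
  -- If the reduct of `t` is a `μˡ`, so is `t`, and the new `μ`-contractum is a reduct of the old
  -- one. In the `μ̃`-contractum the substituted term reduces, possibly at many occurrences.
  ; (cut₁ p)    → SN-cut (a′ p) b (λ { refl → f′ p })
                    (λ { {d} refl → SN-⟶* (g refl) ([]ˡ-⟶* d p) })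
  ; (cut₂ p)    → SN-cut a (b′ p) (λ { {d} refl → SN-⟶* (f refl) ([]ʳ-⟶* d p) })
                    (λ { refl → g′ p })
  }
  where
  f′ : ∀ {d} → t ⟶ μˡ d → SN (d [ u ]ʳ)
  f′ (μˡ-cong p) = acc-inverse (f refl) (subst-⟶ _ _ p)

  g′ : ∀ {d} → u ⟶ μʳ d → SN (d [ t ]ˡ)
  g′ (μʳ-cong p) = acc-inverse (g refl) (subst-⟶ _ _ p)

-- Induction along reducts and subterms

infix 4 _◃_

data _◃_ : ∀ {k₁ m₁ n₁ k m n} → Term k₁ m₁ n₁ → Term k m n → Set where
  cut₁ : {t : Term l m n} {u : Term r m n} → t ◃ ⟨ t ∣ u ⟩
  cut₂ : {t : Term l m n} {u : Term r m n} → u ◃ ⟨ t ∣ u ⟩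
  ƛˡ   : {t : Term l (suc m) n} → t ◃ ƛˡ t
  μˡ   : {d : Term c m (suc n)} → d ◃ μˡ d
  ·ˡ₁  : {u : Term r m n} {t : Term l m n} → u ◃ u ·ˡ t
  ·ˡ₂  : {u : Term r m n} {t : Term l m n} → t ◃ u ·ˡ t
  ƛʳ   : {u : Term r m (suc n)} → u ◃ ƛʳ u
  μʳ   : {d : Term c (suc m) n} → d ◃ μʳ d
  ·ʳ₁  : {t : Term l m n} {u : Term r m n} → t ◃ t ·ʳ u
  ·ʳ₂  : {t : Term l m n} {u : Term r m n} → u ◃ t ·ʳ u

-- Accessibility for the union of reduction and immediate subterm. Since `_◃_` changes kind and
-- scope, `Acc` would require terms packed with their indices.
data SN◃ : ∀ {k m n} → Term k m n → Set where
  acc : {t : Term k m n} → (∀ {t′} → t ⟶ t′ → SN◃ t′) →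
        (∀ {k₁ m₁ n₁} {s : Term k₁ m₁ n₁} → s ◃ t → SN◃ s) → SN◃ t

-- Keeping the SN term F t around t avoids having to choose between reducts and
-- subterms in the induction: reducing t reduces F t, descending into t enlarges F.
SN⇒SN◃ : (t : Term k m n) (F : Term k m n → Term k₁ m₁ n₁) →
  (∀ {s s′} → s ⟶ s′ → F s ⟶ F s′) → SN (F t) → SN◃ t
SN⇒SN◃ t F F-cong a@(acc a′) =
  acc (λ {t′} p → SN⇒SN◃ t′ F F-cong (a′ (F-cong p))) (sub t F F-cong a)
  where
  sub : (t : Term k m n) (F : Term k m n → Term k₁ m₁ n₁) →
    (∀ {s s′} → s ⟶ s′ → F s ⟶ F s′) → SN (F t) →
    ∀ {k₂ m₂ n₂} {s : Term k₂ m₂ n₂} → s ◃ t → SN◃ s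
  -- Composing `F` with the constructor leaves the surrounding term, hence `a`, unchanged.
  -- Termination is lexicographic: first `a`, then the term.
  sub ⟨ t ∣ u ⟩ F F-cong a cut₁ = SN⇒SN◃ t _ (F-cong ∘ cut₁) a
  sub ⟨ t ∣ u ⟩ F F-cong a cut₂ = SN⇒SN◃ u _ (F-cong ∘ cut₂) a
  sub (ƛˡ t)    F F-cong a ƛˡ   = SN⇒SN◃ t _ (F-cong ∘ ƛˡ-cong) a
  sub (μˡ d)    F F-cong a μˡ   = SN⇒SN◃ d _ (F-cong ∘ μˡ-cong) a
  sub (u ·ˡ t)  F F-cong a ·ˡ₁  = SN⇒SN◃ u _ (F-cong ∘ ·ˡ₁) a
  sub (u ·ˡ t)  F F-cong a ·ˡ₂  = SN⇒SN◃ t _ (F-cong ∘ ·ˡ₂) a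
  sub (ƛʳ u)    F F-cong a ƛʳ   = SN⇒SN◃ u _ (F-cong ∘ ƛʳ-cong) a
  sub (μʳ d)    F F-cong a μʳ   = SN⇒SN◃ d _ (F-cong ∘ μʳ-cong) a
  sub (t ·ʳ u)  F F-cong a ·ʳ₁  = SN⇒SN◃ t _ (F-cong ∘ ·ʳ₁) a
  sub (t ·ʳ u)  F F-cong a ·ʳ₂  = SN⇒SN◃ u _ (F-cong ∘ ·ʳ₂) a

SN-μˡ⁻ : {d : Term c m (suc n)} → SN (μˡ d) → SN◃ d
SN-μˡ⁻ {d = d} = SN⇒SN◃ d μˡ μˡ-cong

SN-μʳ⁻ : {d : Term c (suc m) n} → SN (μʳ d) → SN◃ d
SN-μʳ⁻ {d = d} = SN⇒SN◃ d μʳ μʳ-cong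

-- Closing the predicates below under renaming by definition avoids having to
-- show that renamings reflect reduction.
SNᴿ : Term k m n → Set
SNᴿ {m = m} {n} t = ∀ {m₁ n₁} (ρ : Ren m m₁) (θ : Ren n n₁) → SN (rename ρ θ t)

SNᴿ⇒SN : {t : Term k m n} → SNᴿ t → SN t
SNᴿ⇒SN {t = t} a = transport SN (rename-id t) (a id id)

SNᴿ-rename : {t : Term k m n} (ρ : Ren m m₁) (θ : Ren n n₁) → SNᴿ t → SNᴿ (rename ρ θ t)
SNᴿ-rename {t = t} ρ θ a ρ₁ θ₁ =
  transport SN (sym (rename-rename (λ _ → refl) (λ _ → refl) t)) (a _ _)

-- `P` is the class of r-terms that may be substituted into the body. `Good SNᴿ` is goodness proper,
-- closed under renaming; `Good IsVarʳ` is the weaker version that accompanies (1).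
record Good (P : ∀ {m n} → Term r m n → Set) (t : Term l m n) : Set where
  field
    sn       : SNᴿ t
    contract : ∀ {m₁ n₁} (ρ : Ren m m₁) (θ : Ren n n₁) {d} → rename ρ θ t ≡ μˡ d →
               ∀ {u} → P u → SN (d [ u ]ʳ)

open Good

contract-id : ∀ {P : ∀ {m n} → Term r m n → Set} {t : Term l m n} {d} →
  Good P t → t ≡ μˡ d → ∀ {u} → P u → SN (d [ u ]ʳ)
contract-id {t = t} g e = contract g id id (trans (rename-id t) e)

Good-rename : ∀ {P : ∀ {m n} → Term r m n → Set} {t : Term l m n}
  (ρ : Ren m m₁) (θ : Ren n n₁) → Good P t → Good P (rename ρ θ t)
Good-rename ρ θ g .sn = SNᴿ-rename ρ θ (g .sn)
Good-rename {t = t} ρ θ g .contract ρ₁ θ₁ e =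
  g .contract _ _ (trans (sym (rename-rename (λ _ → refl) (λ _ → refl) t)) e)

Good-varˡ : ∀ {P : ∀ {m n} → Term r m n → Set} {x} → Good P (varˡ {m} {n} x)
Good-varˡ .sn _ _ = SN-varˡ
Good-varˡ .contract _ _ ()

-- Both substitution lemmas: P holds of the variables only in the first one and
-- of all SN r-terms in the second one.
module Substitution
  (P : ∀ {m n} → Term r m n → Set)
  (P⇒SNᴿ : ∀ {m n} {u : Term r m n} → P u → SNᴿ u)
  (P-varʳ : ∀ {m n} {α} → P {m} {n} (varʳ α))
  (P-rename : ∀ {m m₁ n n₁} {u : Term r m n} (ρ : Ren m m₁) (θ : Ren n n₁) →
    P u → P (rename ρ θ u))
  -- This settles the cuts `⟨p|α⟩`. It is vacuous for variables; for SN r-terms it is supplied by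
  -- (1).
  (P-contract : ∀ {m n} {d : Term c (suc m) n} → P (μʳ d) →
    ∀ {t} → Good P t → SN (d [ t ]ˡ))
  where

  Goodˡ : Subˡ m m₁ n₁ → Set
  Goodˡ σ = ∀ x → Good SNᴿ (σ x)

  Allʳ : Subʳ n m₁ n₁ → Set
  Allʳ τ = ∀ α → P (τ α)

  extˡ-Good : {σ : Subˡ m m₁ n₁} → Goodˡ σ → Goodˡ (extˡ σ)
  extˡ-Good gσ zero    = Good-varˡ
  extˡ-Good gσ (suc x) = Good-rename suc id (gσ x)

  extʳ-All : {τ : Subʳ n m₁ n₁} → Allʳ τ → Allʳ (extʳ τ)
  extʳ-All pτ zero    = P-varʳ
  extʳ-All pτ (suc α) = P-rename id suc (pτ α)

  wkʳ-Good : {σ : Subˡ m m₁ n₁} → Goodˡ σ → Goodˡ (wkʳ ∘ σ)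
  wkʳ-Good gσ = Good-rename id suc ∘ gσ

  wkˡ-All : {τ : Subʳ n m₁ n₁} → Allʳ τ → Allʳ (wkˡ ∘ τ)
  wkˡ-All pτ = P-rename suc id ∘ pτ

  mutual
    SN-subst : {t : Term k m n} {σ : Subˡ m m₁ n₁} {τ : Subʳ n m₁ n₁} →
      SN◃ t → Goodˡ σ → Allʳ τ → SN (subst σ τ t)
    SN-subst {t = ⟨ t ∣ u ⟩} {σ} {τ} (acc a b) gσ pτ =
      SN-cut (SN-subst (b cut₁) gσ pτ) (SN-subst (b cut₂) gσ pτ) (left t refl) (right u refl)
      where
      left : ∀ t₁ → t ≡ t₁ → ∀ {d} → subst σ τ t₁ ≡ μˡ d → SN (d [ subst σ τ u ]ʳ)
      -- Here the `μˡ` comes from `σ x`, whose goodness covers the substituted `u`. In the next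
      -- clause it is already in `t`, so the contractum is a substituted reduct of the cut.
      left (varˡ x) _    e    = contract-id (gσ x) e (SNᴿ-subst (b cut₂) gσ pτ)
      left (μˡ d)   refl refl =
        transport SN (subst-[]ʳ σ τ d u) (SN-subst (a (μ-red d u)) gσ pτ)

      right : ∀ u₁ → u ≡ u₁ → ∀ {d} → subst σ τ u₁ ≡ μʳ d → SN (d [ subst σ τ t ]ˡ)
      -- Here the `μʳ` comes from `τ α`. The left side is good by induction on the subterm `t`.
      right (varʳ α) _    e    =
        P-contract (transport P e (pτ α)) (Good-subst (b cut₁) gσ pτ)
      right (μʳ d)   refl refl =
        transport SN (subst-[]ˡ σ τ d t) (SN-subst (a (μ̃-red t d)) gσ pτ)
    SN-subst {t = varˡ x} _ gσ pτ = SNᴿ⇒SN (gσ x .sn)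
    SN-subst {t = ƛˡ t} (acc _ b) gσ pτ =
      SN-ƛˡ (SN-subst (b ƛˡ) (extˡ-Good gσ) (wkˡ-All pτ))
    SN-subst {t = μˡ d} (acc _ b) gσ pτ =
      SN-μˡ (SN-subst (b μˡ) (wkʳ-Good gσ) (extʳ-All pτ))
    SN-subst {t = u ·ˡ t} (acc _ b) gσ pτ =
      SN-·ˡ (SN-subst (b ·ˡ₁) gσ pτ) (SN-subst (b ·ˡ₂) gσ pτ)
    SN-subst {t = varʳ α} _ gσ pτ = SNᴿ⇒SN (P⇒SNᴿ (pτ α))
    SN-subst {t = ƛʳ u} (acc _ b) gσ pτ =
      SN-ƛʳ (SN-subst (b ƛʳ) (wkʳ-Good gσ) (extʳ-All pτ))
    SN-subst {t = μʳ d} (acc _ b) gσ pτ =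
      SN-μʳ (SN-subst (b μʳ) (extˡ-Good gσ) (wkˡ-All pτ))
    SN-subst {t = t ·ʳ u} (acc _ b) gσ pτ =
      SN-·ʳ (SN-subst (b ·ʳ₁) gσ pτ) (SN-subst (b ·ʳ₂) gσ pτ)

    -- A further renaming is absorbed into the substituted terms, because `Good` and `P` are closed
    -- under renaming.
    SNᴿ-subst : {t : Term k m n} {σ : Subˡ m m₁ n₁} {τ : Subʳ n m₁ n₁} →
      SN◃ t → Goodˡ σ → Allʳ τ → SNᴿ (subst σ τ t)
    SNᴿ-subst {t = t} a gσ pτ ρ θ =
      transport SN (sym (rename-subst (λ _ → refl) (λ _ → refl) t))
        (SN-subst a (Good-rename ρ θ ∘ gσ) (P-rename ρ θ ∘ pτ))

    Good-subst : {t : Term l m n} {σ : Subˡ m m₁ n₁} {τ : Subʳ n m₁ n₁} →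
      SN◃ t → Goodˡ σ → Allʳ τ → Good P (subst σ τ t)
    Good-subst a gσ pτ .sn = SNᴿ-subst a gσ pτ
    Good-subst {t = t} a gσ pτ .contract ρ θ e pu =
      root t a (Good-rename ρ θ ∘ gσ) (P-rename ρ θ ∘ pτ)
        (trans (sym (rename-subst (λ _ → refl) (λ _ → refl) t)) e) pu

    -- A `μˡ` at the root comes either from `σ x`, which is good, or from `t` itself; in that case
    -- `u` is adjoined to `τ` and the induction continues in the body.
    root : (t : Term l m n) {σ : Subˡ m m₁ n₁} {τ : Subʳ n m₁ n₁} →
      SN◃ t → Goodˡ σ → Allʳ τ → ∀ {d} → subst σ τ t ≡ μˡ d → ∀ {u} → P u → SN (d [ u ]ʳ)
    root (varˡ x) _ gσ pτ e pu = contract-id (gσ x) e (P⇒SNᴿ pu)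
    root (μˡ d) {σ} {τ} (acc _ b) gσ pτ refl {u} pu =
      transport SN (sym (subst-ext-[]ʳ σ τ d u))
        (SN-subst (b μˡ) gσ λ { zero → pu ; (suc α) → pτ α })

-- The two instances: r-variables, then SN r-terms

data IsVarʳ : Term r m n → Set where
  isVarʳ : ∀ {α} → IsVarʳ {m} {n} (varʳ α)

IsVarʳ⇒SNᴿ : {u : Term r m n} → IsVarʳ u → SNᴿ u
IsVarʳ⇒SNᴿ isVarʳ _ _ = SN-varʳ

IsVarʳ-rename : {u : Term r m n} (ρ : Ren m m₁) (θ : Ren n n₁) → IsVarʳ u → IsVarʳ (rename ρ θ u)
IsVarʳ-rename _ _ isVarʳ = isVarʳ

IsVarʳ-contract : {d : Term c (suc m) n} → IsVarʳ (μʳ d) →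
  ∀ {t} → Good IsVarʳ t → SN (d [ t ]ˡ)
IsVarʳ-contract ()

module Substˡ = Substitution IsVarʳ IsVarʳ⇒SNᴿ isVarʳ IsVarʳ-rename IsVarʳ-contract

-- Instance of (1) with `t` for the bound variable and variables elsewhere. It provides `P-contract`
-- for the second instance.
SN-contractʳ : {d : Term c (suc m) n} → SN (μʳ d) → {t : Term l m n} → Good SNᴿ t → SN (d [ t ]ˡ)
SN-contractʳ a g =
  Substˡ.SN-subst (SN-μʳ⁻ a) (λ { zero → g ; (suc x) → Good-varˡ }) (λ _ → isVarʳ)

module Substʳ = Substitution SNᴿ
  (λ a → a) (λ _ _ → SN-varʳ) SNᴿ-rename (λ a → SN-contractʳ (SNᴿ⇒SN a))

-- Apply (2) to the identity substitution, whose l-variables are good and whose r-variables are SN.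
SN⇒Good : {t : Term l m n} → SN t → Good SNᴿ t
SN⇒Good {t = t} a = transport (Good SNᴿ) (subst-var (λ _ → refl) (λ _ → refl) t)
  (Substʳ.Good-subst (SN⇒SN◃ t id id a) (λ _ → Good-varˡ) (λ _ _ _ → SN-varʳ))

-- Structural induction. Quantifying over renamings gives `SNᴿ` for the right side of a cut, as
-- goodness of the left side demands.
strongly-normalising : (t : Term k m n) → SNᴿ t
strongly-normalising ⟨ t ∣ u ⟩ ρ θ =
  SN-cut snt snu
    -- The `μ`-contraction is handled by goodness of the left side, the `μ̃`-contraction by (1).
    (λ e → contract-id good e (SNᴿ-rename ρ θ (strongly-normalising u)))
    (λ e → SN-contractʳ (transport SN e snu) good)
  where
  snt  = strongly-normalising t ρ θ
  snu  = strongly-normalising u ρ θ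
  good = SN⇒Good snt
strongly-normalising (varˡ x) ρ θ = SN-varˡ
strongly-normalising (ƛˡ t)   ρ θ = SN-ƛˡ (strongly-normalising t _ _)
strongly-normalising (μˡ d)   ρ θ = SN-μˡ (strongly-normalising d _ _)
strongly-normalising (u ·ˡ t) ρ θ =
  SN-·ˡ (strongly-normalising u ρ θ) (strongly-normalising t ρ θ)
strongly-normalising (varʳ α) ρ θ = SN-varʳ
strongly-normalising (ƛʳ u)   ρ θ = SN-ƛʳ (strongly-normalising u _ _)
strongly-normalising (μʳ d)   ρ θ = SN-μʳ (strongly-normalising d _ _)
strongly-normalising (t ·ʳ u) ρ θ =
  SN-·ʳ (strongly-normalising t ρ θ) (strongly-normalising u ρ θ)

SN⇒no-infinite-sequence : (f : ℕ → Term k m n) → InfiniteDescendingSequence _⟵_ f →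
  ∀ i → ¬ SN (f i)
SN⇒no-infinite-sequence f s i (acc a) = SN⇒no-infinite-sequence f s (suc i) (a (s i))

theorem3p13 : (k : Kind) (m n : ℕ) (t : Term k m n) →
    ¬ (∃[ f ] InfiniteDescendingSequenceFrom _⟵_ f t)
theorem3p13 k m n t (f , _ , s) =
  SN⇒no-infinite-sequence f s 0 (SNᴿ⇒SN (strongly-normalising (f 0)))
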